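{- Let $k\geq 1$ be an integer. For any integers $\delta$ and $\Delta$ such that $\Delta\geq \delta\geq k+1$, there exists an infinite family $\mathcal{F}$ of (pairwise non-isomorphic) graphs with minimum degree $\delta$ and maximum degree $\Delta$, such that for every graph $G\in \mathcal{F}$, $$\gamma_{kS}(G) = |V(G)|\cdot\frac{\delta-\Delta+2k+I_{\delta}+I_{\Delta}}{\delta+\Delta+2+I_{\delta}-I_{\Delta}}\;.$$
   Context: All graphs are finite, simple and undirected, with nonempty vertex set. For each integer $n$, $I_n=1$ if $n\equiv k\pmod 2$, and $I_n=0$ otherwise. For a vertex $v$ of $G$, $N_G[v]$ denotes the closed neighborhood of $v$ (the set consisting of $v$ and all vertices adjacent to $v$). For $G$ of minimum degree at least $k-1$, a function $f:V(G)\rightarrow\{ -1,1\}$ is a signed $k$-dominating function of $G$ if $\sum_{u\in N_G[v]}f(u)\geq k$ for all $v\in V(G)$. The signed $k$-domination number $\gamma_{kS}(G)$ is the minimum of $\sum_{v\in V(G)}f(v)$ over all signed $k$-dominating functions $f$ of $G$. -}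

module Defs where

open import Data.Fin.Base using (Fin)
open import Data.Integer.Base as ℤ using (ℤ; +_; 0ℤ; _◃_)
open import Data.List.Base using (List; _∷_; allFin; filter; foldr; length; map)
open import Data.Nat.Base as ℕ using (ℕ; NonZero; _%_; _∸_)
import Data.Nat.Properties as ℕ
open import Data.Product.Base using (_×_; ∃-syntax)
open import Data.Rational.Base as ℚ using (ℚ)
open import Data.Sign.Base using (Sign)
open import Function.Bundles using (_⇔_; _↔_; Inverse)
open import Level using (0ℓ)
open import Relation.Binary.Core using (Rel)
open import Relation.Binary.Definitions using (Decidable; Irreflexive; Symmetric)
open import Relation.Binary.PropositionalEquality using (_≡_)
open import Relation.Nullary.Decidable.Core using (yes; no)

record Graph : Set₁ where
  field
    order           : ℕ
    .{{nonempty}}   : NonZero order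
    _~_             : Rel (Fin order) 0ℓ
    _~?_            : Decidable _~_
    ~-symmetric     : Symmetric _~_
    ~-irreflexive   : Irreflexive _≡_ _~_

  Vertex : Set
  Vertex = Fin order

  vertices : List Vertex
  vertices = allFin order

  neighbours : Vertex → List Vertex
  neighbours v = filter (v ~?_) vertices

  -- Duplicate-free, since v is not among its own neighbours.
  closedNeighbourhood : Vertex → List Vertex
  closedNeighbourhood v = v ∷ neighbours v

  degree : Vertex → ℕ
  degree v = length (neighbours v)

open Graph

MinDegree : Graph → ℕ → Set
MinDegree G δ = (∃[ v ] degree G v ≡ δ) × (∀ v → δ ℕ.≤ degree G v)

MaxDegree : Graph → ℕ → Set
MaxDegree G Δ = (∃[ v ] degree G v ≡ Δ) × (∀ v → degree G v ℕ.≤ Δ)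

-- Adjacency may be proof-relevant, so only logical equivalence is required.
record _≅_ (G H : Graph) : Set where
  field
    bijection  : Vertex G ↔ Vertex H
    preserves  : ∀ u v → _~_ G u v ⇔
                   _~_ H (Inverse.to bijection u) (Inverse.to bijection v)

sum : List ℤ → ℤ
sum = foldr ℤ._+_ 0ℤ

-- A sign s stands for the integer s ◃ 1, that is 1 or -1.
sumOver : {A : Set} → List A → (A → Sign) → ℤ
sumOver xs f = sum (map (λ x → f x ◃ 1) xs)

weight : (G : Graph) → (Vertex G → Sign) → ℤ
weight G f = sumOver (vertices G) f

-- The minimum degree being at least k - 1 is not a separate hypothesis: if
-- such an f exists then k ≤ |N[v]| = degree v + 1 for every v.
SignedDominating : ℕ → (G : Graph) → (Vertex G → Sign) → Set
SignedDominating k G f = ∀ v → + k ℤ.≤ sumOver (closedNeighbourhood G v) f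

-- γ is the minimum weight of the signed k-dominating functions of G.
record IsSignedDominationNumber (k : ℕ) (G : Graph) (γ : ℤ) : Set where
  field
    attained    : ∃[ f ] SignedDominating k G f × weight G f ≡ γ
    lowerBound  : ∀ f → SignedDominating k G f → γ ℤ.≤ weight G f

I : ℕ → ℕ → ℕ
I k n with n % 2 ℕ.≟ k % 2
... | yes _ = 1
... | no  _ = 0

I≤1 : ∀ k n → I k n ℕ.≤ 1
I≤1 k n with n % 2 ℕ.≟ k % 2
... | yes _ = ℕ.≤-refl
... | no  _ = ℕ.z≤n

numerator : ℕ → ℕ → ℕ → ℤ
numerator k δ Δ =
  + δ ℤ.- + Δ ℤ.+ + (2 ℕ.* k) ℤ.+ + I k δ ℤ.+ + I k Δ

-- The subtraction never truncates, as I k Δ ≤ 1.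
denominator : ℕ → ℕ → ℕ → ℕ
denominator k δ Δ = (δ ℕ.+ Δ ℕ.+ 2 ℕ.+ I k δ) ∸ I k Δ

denominator-nonZero : ∀ k δ Δ → NonZero (denominator k δ Δ)
denominator-nonZero k δ Δ = ℕ.>-nonZero (ℕ.m<n⇒0<n∸m
  (ℕ.≤-trans (ℕ.s≤s (I≤1 k Δ))
    (ℕ.≤-trans (ℕ.m≤n+m 2 (δ ℕ.+ Δ)) (ℕ.m≤m+n _ (I k δ)))))

ratio : ℕ → ℕ → ℕ → ℚ
ratio k δ Δ = ℚ._/_ (numerator k δ Δ) (denominator k δ Δ) {{denominator-nonZero k δ Δ}}

fromℤ : ℤ → ℚ
fromℤ i = i ℚ./ 1

{-# OPTIONS --safe #-}
module Submission where

-- Write δ = k + 1 + e and Δ = k + 1 + E, and put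
--   ρ = k + 1 + ⌈E/2⌉,  a = 1 + ⌊E/2⌋,  b = k + 1 + ⌈e/2⌉,  σ = 1 + ⌊e/2⌋,
-- so that ρ + a = Δ + 1 and b + σ = δ + 1.  Disjoint copies of K_{b,a} are
-- indexed by (i , y , z) ∈ Fin c × Fin ρ × Fin σ.  The vertices on the b-side
-- with equal i, z and position form a clique of size ρ, those on the a-side
-- with equal i, y and position a clique of size σ.  The b-side vertices thus
-- have degree Δ and the a-side vertices degree δ, without any parity condition.
--
-- By parity, the closed neighbourhood of a vertex of degree Δ has at most a
-- negative vertices; giving -1 to the whole a-side attains this.  Conversely,
-- count the negative vertices in the closed neighbourhoods of all the b-side
-- vertices: an a-side vertex is counted b times, a b-side vertex ρ ≥ b times,
-- so there are at most cρσa of them.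

open import Defs hiding (sum)
open import Data.Integer.Base using (+_)
open import Data.Nat.Base using (ℕ; _+_; _≤_)
open import Data.Product.Base using (_×_; ∃-syntax; Σ-syntax)
open import Data.Rational.Base using (_*_)
open import Relation.Binary.PropositionalEquality using (_≡_; _≢_)
open import Relation.Nullary.Negation.Core using (¬_)

open import Algebra.Properties.Semiring.Sum using ()
open import Data.Bool.Base using (true; false; if_then_else_)
open import Data.Fin.Base using (Fin; zero; suc; splitAt; combine; remQuot; _↑ˡ_; _↑ʳ_)
open import Data.Fin.Permutation using (↔⇒≡)
import Data.Fin.Properties as Fin
import Data.Integer.Base as ℤ
import Data.Integer.Properties as ℤ
open import Data.Integer.Solver renaming (module +-*-Solver to ℤ-Solver)
open import Data.List.Base using (List; []; _∷_; allFin; filter; length; map; tabulate)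
open import Data.List.Properties using (length-tabulate; map-cong)
open import Data.Nat.Base as ℕ
  using (zero; suc; z≤n; s≤s; NonZero; ⌊_/2⌋; ⌈_/2⌉; _%_)
open import Data.Nat.ListAction using () renaming (sum to sumℕ)
import Data.Nat.Properties as ℕ
open import Data.Nat.Solver using (module +-*-Solver)
open import Data.Product.Base using (_,_; map₂; proj₁; proj₂)
open import Data.Product.Function.NonDependent.Propositional using (_×-↔_)
import Data.Rational.Base as ℚ
import Data.Rational.Properties as ℚ
import Data.Rational.Unnormalised.Base as ℚᵘ
import Data.Rational.Unnormalised.Properties as ℚᵘ
open import Data.Sign.Base using (Sign)
open import Data.Sum.Base using (_⊎_; inj₁; inj₂)
open import Function.Base using (_∘_; const; id)
open import Function.Bundles using (_↔_; Inverse)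
open import Function.Construct.Composition using (_↔-∘_)
open import Function.Construct.Identity using (↔-id)
open import Relation.Binary.Core using (Rel)
open import Relation.Binary.Definitions using (Decidable; Reflexive; Symmetric)
open import Relation.Binary.PropositionalEquality
  using (_≗_; refl; sym; trans; cong; cong₂; subst; module ≡-Reasoning)
open import Relation.Nullary.Decidable.Core using (Dec; does; yes; no; _×-dec_; ¬?)
open import Relation.Nullary.Negation.Core using (contradiction)
open import Level using (0ℓ)
open import Relation.Unary using (Pred) renaming (Decidable to Decidable₁)

-- Finite sums of natural numbers.

module Σℕ = Algebra.Properties.Semiring.Sum ℕ.+-*-semiring

infixl 10 ∑
infixr 1 _⇒_

-- Opaque, so that unification recovers the summand and the guarded term.
opaque
  ∑ : ∀ n → (Fin n → ℕ) → ℕ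
  ∑ n = Σℕ.sum

  syntax ∑ n (λ i → x) = ∑[ i < n ] x

  ∑-cong : ∀ {n} {f g : Fin n → ℕ} → f ≗ g → ∑[ i < n ] f i ≡ ∑[ i < n ] g i
  ∑-cong = Σℕ.sum-cong-≗

  ∑-distrib-+ : ∀ {n} {f g : Fin n → ℕ} →
                ∑[ i < n ] (f i + g i) ≡ ∑[ i < n ] f i + ∑[ i < n ] g i
  ∑-distrib-+ {f = f} {g} = Σℕ.∑-distrib-+ f g

  ∑-comm : ∀ {m n} {f : Fin m → Fin n → ℕ} →
           ∑[ i < m ] ∑[ j < n ] f i j ≡ ∑[ j < n ] ∑[ i < m ] f i j
  ∑-comm {f = f} = Σℕ.∑-comm f

  ∑-const : ∀ n {x} → ∑[ i < n ] x ≡ n ℕ.* x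
  ∑-const zero        = refl
  ∑-const (suc n) {x} = cong (x ℕ.+_) (∑-const n)

  ∑-* : ∀ {n} x {f : Fin n → ℕ} → ∑[ i < n ] (x ℕ.* f i) ≡ x ℕ.* ∑[ i < n ] f i
  ∑-* x {f} = sym (Σℕ.*-distribˡ-sum x f)

  ∑-≤-const : ∀ {n x} {f : Fin n → ℕ} → (∀ i → f i ≤ x) → ∑[ i < n ] f i ≤ n ℕ.* x
  ∑-≤-const {zero}  f≤x = z≤n
  ∑-≤-const {suc n} f≤x = ℕ.+-mono-≤ (f≤x zero) (∑-≤-const (f≤x ∘ suc))

  ∑-↑ : ∀ m {n} (f : Fin (m + n) → ℕ) →
        ∑[ i < m + n ] f i ≡ ∑[ i < m ] f (i ↑ˡ n) + ∑[ j < n ] f (m ↑ʳ j)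
  ∑-↑ zero    f = refl
  ∑-↑ (suc m) f = trans (cong (f zero ℕ.+_) (∑-↑ m (f ∘ suc))) (sym (ℕ.+-assoc (f zero) _ _))

  ∑-combine : ∀ m {n} (f : Fin (m ℕ.* n) → ℕ) →
              ∑[ u < m ℕ.* n ] f u ≡ ∑[ i < m ] ∑[ j < n ] f (combine i j)
  ∑-combine zero        f = refl
  ∑-combine (suc m) {n} f =
    trans (∑-↑ n f) (cong (∑ n (f ∘ (_↑ˡ m ℕ.* n)) ℕ.+_) (∑-combine m (f ∘ (n ↑ʳ_))))

  sumℕ-tabulate : ∀ {A : Set} (g : A → ℕ) {n} (h : Fin n → A) →
                  sumℕ (map g (tabulate h)) ≡ ∑[ i < n ] g (h i)
  sumℕ-tabulate g {zero}  h = refl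
  sumℕ-tabulate g {suc n} h = cong (g (h zero) ℕ.+_) (sumℕ-tabulate g (h ∘ suc))

∑-0 : ∀ n → ∑[ i < n ] 0 ≡ 0
∑-0 n = trans (∑-const n) (ℕ.*-zeroʳ n)

∑-1 : ∀ n → ∑[ i < n ] 1 ≡ n
∑-1 n = trans (∑-const n) (ℕ.*-identityʳ n)

∑-splitAt : ∀ m {n} (f : Fin m ⊎ Fin n → ℕ) →
            ∑[ i < m + n ] f (splitAt m i) ≡ ∑[ i < m ] f (inj₁ i) + ∑[ j < n ] f (inj₂ j)
∑-splitAt m {n} f = trans (∑-↑ m (f ∘ splitAt m)) (cong₂ _+_
  (∑-cong λ i → cong f (Fin.splitAt-↑ˡ m i n))
  (∑-cong λ j → cong f (Fin.splitAt-↑ʳ m n j)))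

-- The inner enumeration `d` comes with its own summation `∑ₐ`, so the lemma can be iterated along a
-- nested product, one factor at a time.
∑-remQuot : ∀ m {n} {A : Set} (d : Fin n → A) (∑ₐ : (A → ℕ) → ℕ) →
            (∀ g → ∑[ j < n ] g (d j) ≡ ∑ₐ g) →
            ∀ (g : Fin m × A → ℕ) →
            ∑[ u < m ℕ.* n ] g (map₂ d (remQuot n u)) ≡ ∑[ i < m ] ∑ₐ (λ x → g (i , x))
∑-remQuot m {n} d ∑ₐ ∑-d g = trans (∑-combine m (g ∘ map₂ d ∘ remQuot n)) (∑-cong λ i →
  trans (∑-cong λ j → cong (g ∘ map₂ d) (Fin.remQuot-combine {m} i j)) (∑-d (λ x → g (i , x))))

-- Sums guarded by a decidable condition.

opaque
  _⇒_ : {P : Set} → Dec P → ℕ → ℕ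
  d ⇒ x = if does d then x else 0

  ⇒-×-dec : {P Q : Set} (d : Dec P) (e : Dec Q) → ∀ {x} → (d ×-dec e ⇒ x) ≡ (d ⇒ e ⇒ x)
  ⇒-×-dec d e with does d
  ... | true  = refl
  ... | false = refl

  ⇒-distribˡ-+ : {P : Set} (d : Dec P) → ∀ {x y} → (d ⇒ x) + (d ⇒ y) ≡ (d ⇒ x + y)
  ⇒-distribˡ-+ d with does d
  ... | true  = refl
  ... | false = refl

  -- Meant for `d` deciding equality with a centre and `e` deciding adjacency or equality: the
  -- closed neighbourhood splits into the centre and its neighbours.
  ⇒-complement : {P Q : Set} (d : Dec P) (e : Dec Q) → (P → Q) →
                 ∀ {x} → (d ⇒ x) + (e ×-dec ¬? d ⇒ x) ≡ (e ⇒ x)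
  ⇒-complement (yes _) (yes _) P⇒Q = ℕ.+-identityʳ _
  ⇒-complement (yes p) (no ¬q) P⇒Q = contradiction (P⇒Q p) ¬q
  ⇒-complement (no  _) (yes _) P⇒Q = refl
  ⇒-complement (no  _) (no  _) P⇒Q = refl

  ∑-⇒ : {P : Set} (d : Dec P) → ∀ {n} {f : Fin n → ℕ} → ∑[ i < n ] (d ⇒ f i) ≡ (d ⇒ ∑[ i < n ] f i)
  ∑-⇒ d {n} with does d
  ... | true  = refl
  ... | false = ∑-0 n

  sumℕ-filter : ∀ {A : Set} {P : Pred A 0ℓ} (P? : Decidable₁ P) (g : A → ℕ) xs →
                sumℕ (map g (filter P? xs)) ≡ sumℕ (map (λ x → P? x ⇒ g x) xs)
  sumℕ-filter P? g []       = refl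
  sumℕ-filter P? g (x ∷ xs) with does (P? x)
  ... | true  = cong (g x ℕ.+_) (sumℕ-filter P? g xs)
  ... | false = sumℕ-filter P? g xs

opaque
  unfolding ∑ _⇒_

  ∑-≟ : ∀ {n} (i : Fin n) {f : Fin n → ℕ} → ∑[ j < n ] (i Fin.≟ j ⇒ f j) ≡ f i
  ∑-≟ {suc n} zero    {f} = trans (cong (f zero ℕ.+_) (∑-0 n)) (ℕ.+-identityʳ _)
  ∑-≟ {suc n} (suc i) {f} = ∑-≟ i {f ∘ suc}

-- Signed sums as counts of negative vertices.

length≡sumℕ : ∀ {A : Set} (xs : List A) → length xs ≡ sumℕ (map (const 1) xs)
length≡sumℕ []       = refl
length≡sumℕ (x ∷ xs) = cong suc (length≡sumℕ xs)

negative : Sign → ℕ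
negative Sign.+ = 0
negative Sign.- = 1

negatives : {A : Set} → List A → (A → Sign) → ℕ
negatives xs f = sumℕ (map (negative ∘ f) xs)

-- Each negative sign replaces 1 by -1, a loss of 2. Domination thereby becomes an inequality
-- between natural numbers.
sumOver-⊖ : ∀ {A : Set} (xs : List A) f → sumOver xs f ≡ length xs ℤ.⊖ 2 ℕ.* negatives xs f
sumOver-⊖ []       f = refl
sumOver-⊖ (x ∷ xs) f with f x
... | Sign.+ = trans (cong (ℤ._+_ (+ 1)) (sumOver-⊖ xs f))
                 (ℤ.distribʳ-⊖-+-pos 1 (length xs) (2 ℕ.* negatives xs f))
... | Sign.- = begin
  ℤ.-[1+ 0 ] ℤ.+ sumOver xs f             ≡⟨ cong (ℤ._+_ ℤ.-[1+ 0 ]) (sumOver-⊖ xs f) ⟩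
  ℤ.-[1+ 0 ] ℤ.+ (l ℤ.⊖ 2 ℕ.* n)          ≡⟨ ℤ.distribʳ-⊖-+-neg 0 l (2 ℕ.* n) ⟩
  l ℤ.⊖ (1 + 2 ℕ.* n)                     ≡⟨ ℤ.[1+m]⊖[1+n]≡m⊖n l (1 + 2 ℕ.* n) ⟨
  suc l ℤ.⊖ (2 + 2 ℕ.* n)                 ≡⟨ cong (suc l ℤ.⊖_) (ℕ.*-suc 2 n) ⟨
  suc l ℤ.⊖ 2 ℕ.* suc n                   ∎
  where
  open ≡-Reasoning
  l = length xs
  n = negatives xs f

≤-⊖⁺ : ∀ {k l n} → k + n ≤ l → + k ℤ.≤ l ℤ.⊖ n
≤-⊖⁺ {k} {l} {n} k+n≤l =
  subst (ℤ._≤ _) (trans (ℤ.⊖-≥ (ℕ.m≤n+m n k)) (cong +_ (ℕ.m+n∸n≡m k n))) (ℤ.⊖-monoˡ-≤ n k+n≤l)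

≤-⊖⁻ : ∀ {k l n} → + k ℤ.≤ l ℤ.⊖ n → k + n ≤ l
≤-⊖⁻ {k} {l} {n} k≤l⊖n = ℕ.≮⇒≥ λ l<k+n → ℤ.<⇒≱
  (subst (_ ℤ.<_) (trans (ℤ.⊖-≥ (ℕ.m≤n+m n k)) (cong +_ (ℕ.m+n∸n≡m k n))) (ℤ.⊖-monoˡ-< n l<k+n))
  k≤l⊖n

-- Graphs from symmetric relations.

module _ {n : ℕ} .{{_ : NonZero n}} {R : Rel (Fin n) 0ℓ}
         (R? : Decidable R) (R-sym : Symmetric R) where

  loopless : Graph
  loopless = record
    { order         = n
    ; _~_           = λ u v → R u v × u ≢ v
    ; _~?_          = λ u v → R? u v ×-dec ¬? (u Fin.≟ v)
    ; ~-symmetric   = λ (Ruv , u≢v) → R-sym Ruv , u≢v ∘ sym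
    ; ~-irreflexive = λ u≡v (_ , u≢v) → u≢v u≡v
    }

  -- The diagonal that `loopless` removes is restored by the centre `v`, so for reflexive `R` the
  -- guard is `R` itself.
  sumℕ-closedNeighbourhood : Reflexive R → ∀ (g : Fin n → ℕ) v →
    sumℕ (map g (Graph.closedNeighbourhood loopless v)) ≡ ∑[ w < n ] (R? v w ⇒ g w)
  sumℕ-closedNeighbourhood R-refl g v = begin
    g v + sumℕ (map g (Graph.neighbours loopless v))
      ≡⟨ cong₂ _+_ (sym (∑-≟ v))
           (trans (sumℕ-filter _ g (allFin n)) (sumℕ-tabulate _ id)) ⟩
    ∑[ w < n ] (v Fin.≟ w ⇒ g w) + ∑[ w < n ] (R? v w ×-dec ¬? (v Fin.≟ w) ⇒ g w)
      ≡⟨ ∑-distrib-+ ⟨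
    ∑[ w < n ] ((v Fin.≟ w ⇒ g w) + (R? v w ×-dec ¬? (v Fin.≟ w) ⇒ g w))
      ≡⟨ ∑-cong (λ w → ⇒-complement (v Fin.≟ w) (R? v w) λ { refl → R-refl }) ⟩
    ∑[ w < n ] (R? v w ⇒ g w) ∎
    where open ≡-Reasoning

-- Coordinates and adjacency of the construction.

module Construction (c ρ σ b a : ℕ) where

  V : Set
  V = Fin c × Fin ρ × Fin σ × (Fin b ⊎ Fin a)

  N : ℕ
  N = c ℕ.* (ρ ℕ.* (σ ℕ.* (b + a)))

  -- The vertices of a `Graph` form a `Fin`, so the coordinates `V` are numbered factor by factor;
  -- the nesting is the one that `∑-decode` follows.
  row : Fin (σ ℕ.* (b + a)) ↔ (Fin σ × (Fin b ⊎ Fin a))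
  row = (↔-id _ ×-↔ Fin.+↔⊎) ↔-∘ Fin.*↔×

  copy : Fin (ρ ℕ.* (σ ℕ.* (b + a))) ↔ (Fin ρ × Fin σ × (Fin b ⊎ Fin a))
  copy = (↔-id _ ×-↔ row) ↔-∘ Fin.*↔×

  enumeration : Fin N ↔ V
  enumeration = (↔-id _ ×-↔ copy) ↔-∘ Fin.*↔×

  decode : Fin N → V
  decode = Inverse.to enumeration

  encode : V → Fin N
  encode = Inverse.from enumeration

  decode-encode : ∀ v → decode (encode v) ≡ v
  decode-encode = Inverse.strictlyInverseˡ enumeration

  encode-decode : ∀ u → encode (decode u) ≡ u
  encode-decode = Inverse.strictlyInverseʳ enumeration

  ∑-cell : (Fin b ⊎ Fin a → ℕ) → ℕ
  ∑-cell g = ∑[ p < b ] g (inj₁ p) + ∑[ q < a ] g (inj₂ q)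

  ∑-row : (Fin σ × (Fin b ⊎ Fin a) → ℕ) → ℕ
  ∑-row g = ∑[ z < σ ] ∑-cell (λ u → g (z , u))

  ∑-copy : (Fin ρ × Fin σ × (Fin b ⊎ Fin a) → ℕ) → ℕ
  ∑-copy g = ∑[ y < ρ ] ∑-row (λ u → g (y , u))

  ∑ᵥ : (V → ℕ) → ℕ
  ∑ᵥ g = ∑[ i < c ] ∑-copy (λ u → g (i , u))

  ∑-decode : ∀ g → ∑[ u < N ] g (decode u) ≡ ∑ᵥ g
  ∑-decode =
    ∑-remQuot c (Inverse.to copy) ∑-copy (
    ∑-remQuot ρ (Inverse.to row) ∑-row (
    ∑-remQuot σ (splitAt b) ∑-cell (
    ∑-splitAt b)))

  -- Adjacent or equal.
  CloseInCopy : Rel (Fin ρ × Fin σ × (Fin b ⊎ Fin a)) 0ℓ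
  CloseInCopy (y , z , inj₁ p) (y′ , z′ , inj₁ p′) = z ≡ z′ × p ≡ p′
  CloseInCopy (y , z , inj₁ _) (y′ , z′ , inj₂ _)  = y ≡ y′ × z ≡ z′
  CloseInCopy (y , z , inj₂ _) (y′ , z′ , inj₁ _)  = y ≡ y′ × z ≡ z′
  CloseInCopy (y , z , inj₂ q) (y′ , z′ , inj₂ q′) = y ≡ y′ × q ≡ q′

  closeInCopy? : Decidable CloseInCopy
  closeInCopy? (y , z , inj₁ p) (y′ , z′ , inj₁ p′) = z Fin.≟ z′ ×-dec p Fin.≟ p′
  closeInCopy? (y , z , inj₁ _) (y′ , z′ , inj₂ _)  = y Fin.≟ y′ ×-dec z Fin.≟ z′
  closeInCopy? (y , z , inj₂ _) (y′ , z′ , inj₁ _)  = y Fin.≟ y′ ×-dec z Fin.≟ z′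
  closeInCopy? (y , z , inj₂ q) (y′ , z′ , inj₂ q′) = y Fin.≟ y′ ×-dec q Fin.≟ q′

  closeInCopy-refl : Reflexive CloseInCopy
  closeInCopy-refl {_ , _ , inj₁ _} = refl , refl
  closeInCopy-refl {_ , _ , inj₂ _} = refl , refl

  closeInCopy-sym : Symmetric CloseInCopy
  closeInCopy-sym {_ , _ , inj₁ _} {_ , _ , inj₁ _} (refl , refl) = refl , refl
  closeInCopy-sym {_ , _ , inj₁ _} {_ , _ , inj₂ _} (refl , refl) = refl , refl
  closeInCopy-sym {_ , _ , inj₂ _} {_ , _ , inj₁ _} (refl , refl) = refl , refl
  closeInCopy-sym {_ , _ , inj₂ _} {_ , _ , inj₂ _} (refl , refl) = refl , refl

  Close : Rel V 0ℓ
  Close (i , u) (i′ , u′) = i ≡ i′ × CloseInCopy u u′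

  close? : Decidable Close
  close? (i , u) (i′ , u′) = i Fin.≟ i′ ×-dec closeInCopy? u u′

  -- Sums over closed neighbourhoods: a clique and the opposite side of a `K_{b,a}`.

  ballSum : (V → ℕ) → V → ℕ
  ballSum g (i , y , z , inj₁ p) = ∑[ y′ < ρ ] g (i , y′ , z , inj₁ p) + ∑[ q < a ] g (i , y , z , inj₂ q)
  ballSum g (i , y , z , inj₂ q) = ∑[ p < b ] g (i , y , z , inj₁ p) + ∑[ z′ < σ ] g (i , y , z′ , inj₂ q)

  ∑-copy-close : ∀ (g : V → ℕ) i u →
    ∑-copy (λ w → closeInCopy? u w ⇒ g (i , w)) ≡ ballSum g (i , u)
  ∑-copy-close g i (y , z , inj₁ p) = begin
    ∑-copy (λ w → closeInCopy? (y , z , inj₁ p) w ⇒ g (i , w))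
      ≡⟨ (∑-cong λ y′ → ∑-cong λ z′ → cong₂ _+_
           (trans (∑-cong λ _ → ⇒-×-dec (z Fin.≟ z′) (p Fin.≟ _))
             (trans (∑-⇒ (z Fin.≟ z′)) (cong (z Fin.≟ z′ ⇒_) (∑-≟ p))))
           (trans (∑-⇒ (y Fin.≟ y′ ×-dec z Fin.≟ z′)) (⇒-×-dec (y Fin.≟ y′) (z Fin.≟ z′)))) ⟩
    ∑[ y′ < ρ ] ∑[ z′ < σ ] ((z Fin.≟ z′ ⇒ G₁ y′ z′) + (y Fin.≟ y′ ⇒ z Fin.≟ z′ ⇒ G₂ y′ z′))
      ≡⟨ (∑-cong λ y′ → trans ∑-distrib-+
           (cong₂ _+_ (∑-≟ z) (trans (∑-⇒ (y Fin.≟ y′)) (cong (y Fin.≟ y′ ⇒_) (∑-≟ z))))) ⟩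
    ∑[ y′ < ρ ] (G₁ y′ z + (y Fin.≟ y′ ⇒ G₂ y′ z))
      ≡⟨ trans ∑-distrib-+ (cong (∑[ y′ < ρ ] G₁ y′ z ℕ.+_) (∑-≟ y)) ⟩
    ballSum g (i , y , z , inj₁ p) ∎
    where
    open ≡-Reasoning
    G₁ G₂ : Fin ρ → Fin σ → ℕ
    G₁ y′ z′ = g (i , y′ , z′ , inj₁ p)
    G₂ y′ z′ = ∑[ q < a ] g (i , y′ , z′ , inj₂ q)
  ∑-copy-close g i (y , z , inj₂ q) = begin
    ∑-copy (λ w → closeInCopy? (y , z , inj₂ q) w ⇒ g (i , w))
      ≡⟨ (∑-cong λ y′ → ∑-cong λ z′ → cong₂ _+_
           (trans (∑-⇒ (y Fin.≟ y′ ×-dec z Fin.≟ z′)) (⇒-×-dec (y Fin.≟ y′) (z Fin.≟ z′)))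
           (trans (∑-cong λ _ → ⇒-×-dec (y Fin.≟ y′) (q Fin.≟ _))
             (trans (∑-⇒ (y Fin.≟ y′)) (cong (y Fin.≟ y′ ⇒_) (∑-≟ q))))) ⟩
    ∑[ y′ < ρ ] ∑[ z′ < σ ] ((y Fin.≟ y′ ⇒ z Fin.≟ z′ ⇒ G₁ y′ z′) + (y Fin.≟ y′ ⇒ G₂ y′ z′))
      -- For an a-side centre both the clique and the opposite side fix `y`, so this guard is
      -- factored out and the sum over `y′` collapses once for both.
      ≡⟨ (∑-cong λ y′ → trans (∑-cong λ _ → ⇒-distribˡ-+ (y Fin.≟ y′))
           (∑-⇒ (y Fin.≟ y′))) ⟩
    ∑[ y′ < ρ ] (y Fin.≟ y′ ⇒ ∑[ z′ < σ ] ((z Fin.≟ z′ ⇒ G₁ y′ z′) + G₂ y′ z′))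
      ≡⟨ ∑-≟ y ⟩
    ∑[ z′ < σ ] ((z Fin.≟ z′ ⇒ G₁ y z′) + G₂ y z′)
      ≡⟨ trans ∑-distrib-+ (cong (ℕ._+ ∑ σ (G₂ y)) (∑-≟ z)) ⟩
    ballSum g (i , y , z , inj₂ q) ∎
    where
    open ≡-Reasoning
    G₁ G₂ : Fin ρ → Fin σ → ℕ
    G₁ y′ z′ = ∑[ p < b ] g (i , y′ , z′ , inj₁ p)
    G₂ y′ z′ = g (i , y′ , z′ , inj₂ q)

  ∑-copy-⇒ : {P : Set} (d : Dec P) → ∀ g → ∑-copy (λ w → d ⇒ g w) ≡ (d ⇒ ∑-copy g)
  ∑-copy-⇒ d g =
    trans (∑-cong λ _ →
      trans (∑-cong λ _ → trans (cong₂ _+_ (∑-⇒ d) (∑-⇒ d)) (⇒-distribˡ-+ d))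
      (∑-⇒ d))
    (∑-⇒ d)

  ∑-copy-cong : ∀ g h → g ≗ h → ∑-copy g ≡ ∑-copy h
  ∑-copy-cong g h g≗h = ∑-cong λ _ → ∑-cong λ _ →
    cong₂ _+_ (∑-cong λ _ → g≗h _) (∑-cong λ _ → g≗h _)

  ∑ᵥ-close : ∀ g v → ∑ᵥ (λ w → close? v w ⇒ g w) ≡ ballSum g v
  ∑ᵥ-close g v@(i , u) = begin
    ∑ᵥ (λ w → close? v w ⇒ g w)
      ≡⟨ (∑-cong λ i′ → trans
           (∑-copy-cong (λ w → close? v (i′ , w) ⇒ g (i′ , w)) (λ w → i Fin.≟ i′ ⇒ closeInCopy? u w ⇒ g (i′ , w))
             λ w → ⇒-×-dec (i Fin.≟ i′) (closeInCopy? u w))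
           (∑-copy-⇒ (i Fin.≟ i′) (λ w → closeInCopy? u w ⇒ g (i′ , w)))) ⟩
    ∑[ i′ < c ] (i Fin.≟ i′ ⇒ ∑-copy (λ w → closeInCopy? u w ⇒ g (i′ , w)))
      ≡⟨ ∑-≟ i ⟩
    ∑-copy (λ w → closeInCopy? u w ⇒ g (i , w))
      ≡⟨ ∑-copy-close g i u ⟩
    ballSum g v ∎
    where open ≡-Reasoning

  -- Double counting over the b-side centres of one copy.

  ∑-ballSum : ∀ (g : V → ℕ) i →
    ∑[ y < ρ ] ∑[ z < σ ] ∑[ p < b ] ballSum g (i , y , z , inj₁ p)
      ≡ ρ ℕ.* ∑[ y < ρ ] ∑[ z < σ ] ∑[ p < b ] g (i , y , z , inj₁ p) +
        b ℕ.* ∑[ y < ρ ] ∑[ z < σ ] ∑[ q < a ] g (i , y , z , inj₂ q)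
  ∑-ballSum g i = begin
    ∑[ y < ρ ] ∑[ z < σ ] ∑[ p < b ] (∑[ y′ < ρ ] G₁ y′ z p + G₂ y z)
      ≡⟨ (∑-cong λ y → ∑-cong λ z → trans ∑-distrib-+ (cong₂ _+_ ∑-comm (∑-const b))) ⟩
    ∑[ y < ρ ] ∑[ z < σ ] (∑[ y′ < ρ ] ∑[ p < b ] G₁ y′ z p + b ℕ.* G₂ y z)
      ≡⟨ (∑-cong λ y → trans ∑-distrib-+ (cong₂ _+_ ∑-comm (∑-* b))) ⟩
    ∑[ y < ρ ] (∑[ y′ < ρ ] ∑[ z < σ ] ∑[ p < b ] G₁ y′ z p + b ℕ.* ∑[ z < σ ] G₂ y z)
      -- The first summand no longer depends on `y`: every vertex of a clique sees the whole clique,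
      -- whence the factor `ρ`.
      ≡⟨ trans ∑-distrib-+ (cong₂ _+_ (∑-const ρ) (∑-* b)) ⟩
    ρ ℕ.* ∑[ y < ρ ] ∑[ z < σ ] ∑[ p < b ] G₁ y z p + b ℕ.* ∑[ y < ρ ] ∑[ z < σ ] G₂ y z ∎
    where
    open ≡-Reasoning
    G₁ : Fin ρ → Fin σ → Fin b → ℕ
    G₁ y z p = g (i , y , z , inj₁ p)
    G₂ : Fin ρ → Fin σ → ℕ
    G₂ y z = ∑[ q < a ] g (i , y , z , inj₂ q)

  ∑-copy-split : ∀ g →
    ∑-copy g ≡ ∑[ y < ρ ] ∑[ z < σ ] ∑[ p < b ] g (y , z , inj₁ p) +
               ∑[ y < ρ ] ∑[ z < σ ] ∑[ q < a ] g (y , z , inj₂ q)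
  ∑-copy-split g = trans (∑-cong λ _ → ∑-distrib-+) ∑-distrib-+

  -- Since `b ≤ ρ`, every vertex is counted at least `b` times around the `ρσb` centres, and each
  -- centre contributes at most `a`; cancelling `b` gives the bound.
  ∑-copy-≤ : .{{NonZero b}} → b ≤ ρ → ∀ (g : V → ℕ) i →
             (∀ y z p → ballSum g (i , y , z , inj₁ p) ≤ a) →
             ∑-copy (λ u → g (i , u)) ≤ ρ ℕ.* (σ ℕ.* a)
  ∑-copy-≤ b≤ρ g i ball≤a = ℕ.*-cancelˡ-≤ b (begin
    b ℕ.* ∑-copy (λ u → g (i , u))   ≡⟨ cong (b ℕ.*_) (∑-copy-split (λ u → g (i , u))) ⟩
    b ℕ.* (S₁ + S₂)                  ≡⟨ ℕ.*-distribˡ-+ b S₁ S₂ ⟩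
    b ℕ.* S₁ + b ℕ.* S₂              ≤⟨ ℕ.+-monoˡ-≤ (b ℕ.* S₂) (ℕ.*-monoˡ-≤ S₁ b≤ρ) ⟩
    ρ ℕ.* S₁ + b ℕ.* S₂              ≡⟨ ∑-ballSum g i ⟨
    ∑[ y < ρ ] ∑[ z < σ ] ∑[ p < b ] ballSum g (i , y , z , inj₁ p)
      ≤⟨ (∑-≤-const λ y → ∑-≤-const λ z → ∑-≤-const λ p → ball≤a y z p) ⟩
    ρ ℕ.* (σ ℕ.* (b ℕ.* a))
      ≡⟨ solve 4 (λ r s b a → r :* (s :* (b :* a)) := b :* (r :* (s :* a))) refl ρ σ b a ⟩
    b ℕ.* (ρ ℕ.* (σ ℕ.* a))          ∎)
    where
    open ℕ.≤-Reasoning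
    open +-*-Solver
    S₁ = ∑[ y < ρ ] ∑[ z < σ ] ∑[ p < b ] g (i , y , z , inj₁ p)
    S₂ = ∑[ y < ρ ] ∑[ z < σ ] ∑[ q < a ] g (i , y , z , inj₂ q)

  ballSize : V → ℕ
  ballSize (_ , _ , _ , inj₁ _) = ρ + a
  ballSize (_ , _ , _ , inj₂ _) = b + σ

  ballSum-1 : ∀ v → ballSum (const 1) v ≡ ballSize v
  ballSum-1 (_ , _ , _ , inj₁ _) = cong₂ _+_ (∑-1 ρ) (∑-1 a)
  ballSum-1 (_ , _ , _ , inj₂ _) = cong₂ _+_ (∑-1 b) (∑-1 σ)

  -- The graph, its signed domination number and its degrees.

  module _ .{{_ : NonZero N}} where

    closeCode? : Decidable (λ u v → Close (decode u) (decode v))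
    closeCode? u v = close? (decode u) (decode v)

    closeCode-sym : Symmetric (λ u v → Close (decode u) (decode v))
    closeCode-sym (i≡i′ , u~v) = sym i≡i′ , closeInCopy-sym u~v

    G : Graph
    G = loopless closeCode? closeCode-sym

    open Graph G using (closedNeighbourhood; degree)

    sumℕ-ball : ∀ g u → sumℕ (map (g ∘ decode) (closedNeighbourhood u)) ≡ ballSum g (decode u)
    sumℕ-ball g u = begin
      sumℕ (map (g ∘ decode) (closedNeighbourhood u))
        ≡⟨ sumℕ-closedNeighbourhood closeCode? closeCode-sym (refl , closeInCopy-refl) (g ∘ decode) u ⟩
      ∑[ w < N ] (close? (decode u) (decode w) ⇒ g (decode w))
        ≡⟨ ∑-decode (λ w → close? (decode u) w ⇒ g w) ⟩
      ∑ᵥ (λ w → close? (decode u) w ⇒ g w)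
        ≡⟨ ∑ᵥ-close g (decode u) ⟩
      ballSum g (decode u) ∎
      where open ≡-Reasoning

    1+degree : ∀ u → suc (degree u) ≡ ballSize (decode u)
    1+degree u = trans (length≡sumℕ (closedNeighbourhood u))
      (trans (sumℕ-ball (const 1) u) (ballSum-1 (decode u)))

    -- The indicator `g` of negative vertices lives on coordinates and is tied to `f` by `f≗g`. It
    -- serves both for the explicit `sign` and for an arbitrary `f` pulled back along `encode`.
    module _ (f : Fin N → Sign) (g : V → ℕ) (f≗g : negative ∘ f ≗ g ∘ decode) where

      sumOver-ball : ∀ u →
        sumOver (closedNeighbourhood u) f ≡ ballSize (decode u) ℤ.⊖ 2 ℕ.* ballSum g (decode u)
      sumOver-ball u = trans (sumOver-⊖ (closedNeighbourhood u) f)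
        (cong₂ (λ l n → l ℤ.⊖ 2 ℕ.* n) (1+degree u)
          (trans (cong sumℕ (map-cong f≗g (closedNeighbourhood u))) (sumℕ-ball g u)))

      weight-⊖ : weight G f ≡ N ℤ.⊖ 2 ℕ.* ∑ᵥ g
      weight-⊖ = trans (sumOver-⊖ (allFin N) f)
        (cong₂ (λ l n → l ℤ.⊖ 2 ℕ.* n) (length-tabulate id)
          (trans (sumℕ-tabulate (negative ∘ f) id) (trans (∑-cong f≗g) (∑-decode g))))

    γ : ℤ.ℤ
    γ = N ℤ.⊖ 2 ℕ.* (c ℕ.* (ρ ℕ.* (σ ℕ.* a)))

    sign : V → Sign
    sign (_ , _ , _ , inj₁ _) = Sign.+
    sign (_ , _ , _ , inj₂ _) = Sign.-

    module _ {k : ℕ} (k+a≤ρ : k + a ≤ ρ) (k+σ≤b : k + σ ≤ b) where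

      -- The signed sum is `ρ - a` around a b-side vertex and `b - σ` around an a-side one; both are
      -- at least `k`.
      sign-dominating : ∀ v → k + 2 ℕ.* ballSum (negative ∘ sign) v ≤ ballSize v
      sign-dominating (_ , _ , _ , inj₁ _)
        rewrite ∑-0 ρ | ∑-1 a | ℕ.+-identityʳ a | sym (ℕ.+-assoc k a a) = ℕ.+-monoˡ-≤ a k+a≤ρ
      sign-dominating (_ , _ , _ , inj₂ _)
        rewrite ∑-0 b | ∑-1 σ | ℕ.+-identityʳ σ | sym (ℕ.+-assoc k σ σ) = ℕ.+-monoˡ-≤ σ k+σ≤b

      ∑ᵥ-sign : ∑ᵥ (negative ∘ sign) ≡ c ℕ.* (ρ ℕ.* (σ ℕ.* a))
      ∑ᵥ-sign =
        trans (∑-cong λ _ →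
          trans (∑-cong λ _ →
            trans (∑-cong λ _ → cong₂ _+_ (∑-0 b) (∑-1 a)) (∑-const σ))
          (∑-const ρ))
        (∑-const c)

      -- The hypothesis `b ≤ ρ` drives the double count, while `ρ ≤ suc (k + a)` leaves a slack of
      -- at most one around a b-side vertex, too little for another sign change.
      isSignedDominationNumber : .{{NonZero b}} → b ≤ ρ → ρ ≤ suc (k + a) →
                                 IsSignedDominationNumber k G γ
      isSignedDominationNumber b≤ρ ρ≤1+k+a = record
        { attained   = sign ∘ decode , sign∘decode-dominating , weight-sign∘decode
        ; lowerBound = γ≤weight
        }
        where
        sign∘decode-dominating : SignedDominating k G (sign ∘ decode)
        sign∘decode-dominating u = subst (+ k ℤ.≤_)
          (sym (sumOver-ball (sign ∘ decode) (negative ∘ sign) (λ _ → refl) u))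
          (≤-⊖⁺ (sign-dominating (decode u)))

        weight-sign∘decode : weight G (sign ∘ decode) ≡ γ
        weight-sign∘decode = trans (weight-⊖ (sign ∘ decode) (negative ∘ sign) (λ _ → refl))
          (cong (λ n → N ℤ.⊖ 2 ℕ.* n) ∑ᵥ-sign)

        module _ (f : Fin N → Sign) (f-dominating : SignedDominating k G f) where

          g : V → ℕ
          g = negative ∘ f ∘ encode

          f≗g : negative ∘ f ≗ g ∘ decode
          f≗g u = cong (negative ∘ f) (sym (encode-decode u))

          ball-bound : ∀ v → k + 2 ℕ.* ballSum g v ≤ ballSize v
          ball-bound v = subst (λ w → k + 2 ℕ.* ballSum g w ≤ ballSize w) (decode-encode v)
            (≤-⊖⁻ (subst (+ k ℤ.≤_) (sumOver-ball f g f≗g (encode v)) (f-dominating (encode v))))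

          -- With `a + 1` negative vertices the closed neighbourhood would need size at least
          -- `k + 2a + 2`, but it has at most `k + 2a + 1` vertices.
          ball≤a : ∀ i y z p → ballSum g (i , y , z , inj₁ p) ≤ a
          ball≤a i y z p = ℕ.≮⇒≥ λ a<x → ℕ.<⇒≱ (ℕ.n<1+n (suc (k + a + a))) (begin
            suc (suc (k + a + a))
              ≡⟨ solve 2 (λ k a → con 2 :+ (k :+ a :+ a) := k :+ con 2 :* (con 1 :+ a)) refl k a ⟩
            k + 2 ℕ.* suc a                   ≤⟨ ℕ.+-monoʳ-≤ k (ℕ.*-monoʳ-≤ 2 a<x) ⟩
            k + 2 ℕ.* ballSum g (i , y , z , inj₁ p)
              ≤⟨ ball-bound (i , y , z , inj₁ p) ⟩
            ρ + a                             ≤⟨ ℕ.+-monoˡ-≤ a ρ≤1+k+a ⟩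
            suc (k + a + a)                   ∎)
            where
            open ℕ.≤-Reasoning
            open +-*-Solver

          γ≤weight : γ ℤ.≤ weight G f
          γ≤weight = subst (γ ℤ.≤_) (sym (weight-⊖ f g f≗g)) (ℤ.⊖-monoʳ-≥-≤ N
            (ℕ.*-monoʳ-≤ 2 (∑-≤-const λ i → ∑-copy-≤ b≤ρ g i (ball≤a i))))

    degree-encode : ∀ {d} v → ballSize v ≡ suc d → degree (encode v) ≡ d
    degree-encode v size≡ =
      ℕ.suc-injective (trans (1+degree (encode v)) (trans (cong ballSize (decode-encode v)) size≡))

    module _ {δ Δ} (ρ+a≡1+Δ : ρ + a ≡ suc Δ) (b+σ≡1+δ : b + σ ≡ suc δ) (δ≤Δ : δ ≤ Δ) where

      ballSize-bounds : ∀ v → suc δ ≤ ballSize v × ballSize v ≤ suc Δ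
      ballSize-bounds (_ , _ , _ , inj₁ _) rewrite ρ+a≡1+Δ = s≤s δ≤Δ , ℕ.≤-refl
      ballSize-bounds (_ , _ , _ , inj₂ _) rewrite b+σ≡1+δ = ℕ.≤-refl , s≤s δ≤Δ

      -- The `Fin` arguments are the coordinates of a vertex attaining the degree.
      minDegree : Fin c → Fin ρ → Fin σ → Fin a → MinDegree G δ
      minDegree i y z q =
        (encode (i , y , z , inj₂ q) , degree-encode (i , y , z , inj₂ q) b+σ≡1+δ) ,
        λ u → ℕ.s≤s⁻¹ (subst (suc δ ≤_) (sym (1+degree u)) (proj₁ (ballSize-bounds (decode u))))

      maxDegree : Fin c → Fin ρ → Fin σ → Fin b → MaxDegree G Δ
      maxDegree i y z p =
        (encode (i , y , z , inj₁ p) , degree-encode (i , y , z , inj₁ p) ρ+a≡1+Δ) ,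
        λ u → ℕ.s≤s⁻¹ (subst (_≤ suc Δ) (sym (1+degree u)) (proj₂ (ballSize-bounds (decode u))))

  -- The weight as a fraction of the order.

  γ-ratio : (N ℤ.⊖ 2 ℕ.* (c ℕ.* (ρ ℕ.* (σ ℕ.* a)))) ℤ.* + (2 ℕ.* (b + a)) ≡
            + N ℤ.* (+ (2 ℕ.* b) ℤ.- + (2 ℕ.* a))
  γ-ratio = begin
    (N ℤ.⊖ 2 ℕ.* (c ℕ.* (ρ ℕ.* (σ ℕ.* a)))) ℤ.* + (2 ℕ.* (b + a))
      -- The graph contains `t = cρσ` cells `K_{b,a}`, so `N = t(b + a)` and the weight is
      -- `t(b - a)`. The factor 2 is kept to match the fraction in the theorem.
      ≡⟨ cong₂ (λ n m → (n ℤ.⊖ 2 ℕ.* m) ℤ.* + (2 ℕ.* (b + a))) (regroup (b + a)) (regroup a) ⟩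
    (t ℕ.* (b + a) ℤ.⊖ 2 ℕ.* (t ℕ.* a)) ℤ.* + (2 ℕ.* (b + a))
      ≡⟨ cong (ℤ._* + (2 ℕ.* (b + a))) (ℤ.m-n≡m⊖n (t ℕ.* (b + a)) (2 ℕ.* (t ℕ.* a))) ⟨
    (+ (t ℕ.* (b + a)) ℤ.- + (2 ℕ.* (t ℕ.* a))) ℤ.* + (2 ℕ.* (b + a))
      ≡⟨ cong₂ (λ n m → (n ℤ.- (m ℤ.+ (m ℤ.+ + 0))) ℤ.* + (2 ℕ.* (b + a)))
           (ℤ.pos-* t (b + a)) (ℤ.pos-* t a) ⟩
    (+ t ℤ.* + (b + a) ℤ.- (+ t ℤ.* + a ℤ.+ (+ t ℤ.* + a ℤ.+ + 0))) ℤ.* + (2 ℕ.* (b + a))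
      -- The terms `con (+ 0)` mirror the unfolding of `2 ℕ.* n` to `n + (n + 0)`.
      ≡⟨ solve 3 (λ t b a →
           (t :* (b :+ a) :- (t :* a :+ (t :* a :+ con (+ 0)))) :* ((b :+ a) :+ ((b :+ a) :+ con (+ 0)))
             := (t :* (b :+ a)) :* ((b :+ (b :+ con (+ 0))) :- (a :+ (a :+ con (+ 0))))) refl (+ t) (+ b) (+ a) ⟩
    + t ℤ.* + (b + a) ℤ.* (+ (2 ℕ.* b) ℤ.- + (2 ℕ.* a))
      ≡⟨ cong (ℤ._* (+ (2 ℕ.* b) ℤ.- + (2 ℕ.* a)))
           (trans (cong +_ (regroup (b + a))) (ℤ.pos-* t (b + a))) ⟨
    + N ℤ.* (+ (2 ℕ.* b) ℤ.- + (2 ℕ.* a)) ∎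
    where
    open ≡-Reasoning
    open ℤ-Solver
    t = c ℕ.* ρ ℕ.* σ
    regroup : ∀ n → c ℕ.* (ρ ℕ.* (σ ℕ.* n)) ≡ t ℕ.* n
    regroup n = trans (sym (ℕ.*-assoc c ρ _)) (sym (ℕ.*-assoc (c ℕ.* ρ) σ n))

-- Unnormalised rationals are equal by cross-multiplication, so no greatest common divisor has to be
-- handled.
fromℤ-*-/ : ∀ i j p q .{{_ : NonZero q}} → i ℤ.* + q ≡ j ℤ.* p → fromℤ i ≡ fromℤ j * (p ℚ./ q)
fromℤ-*-/ i j p q@(suc q-1) iq≡jp = ℚ.toℚᵘ-injective (begin
  ℚ.toℚᵘ (fromℤ i)                             ≈⟨ ℚ.toℚᵘ-fromℚᵘ (ℚᵘ.mkℚᵘ i 0) ⟩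
  ℚᵘ.mkℚᵘ i 0                                  ≈⟨ ℚᵘ.*≡* cross ⟩
  ℚᵘ.mkℚᵘ j 0 ℚᵘ.* ℚᵘ.mkℚᵘ p q-1
    ≈⟨ ℚᵘ.*-cong (ℚ.toℚᵘ-fromℚᵘ (ℚᵘ.mkℚᵘ j 0)) (ℚ.toℚᵘ-fromℚᵘ (ℚᵘ.mkℚᵘ p q-1)) ⟨
  ℚ.toℚᵘ (fromℤ j) ℚᵘ.* ℚ.toℚᵘ (p ℚ./ q)       ≈⟨ ℚ.toℚᵘ-homo-* (fromℤ j) (p ℚ./ q) ⟨
  ℚ.toℚᵘ (fromℤ j * (p ℚ./ q))                 ∎)
  where
  open ℚᵘ.≃-Reasoning
  cross : i ℤ.* + (1 ℕ.* q) ≡ j ℤ.* p ℤ.* + 1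
  cross = trans (cong (λ n → i ℤ.* + n) (ℕ.*-identityˡ q)) (trans iq≡jp (sym (ℤ.*-identityʳ _)))

-- Parity, and the numerator and denominator of the ratio.

1+n%2≢n%2 : ∀ n → suc n % 2 ≢ n % 2
1+n%2≢n%2 zero          ()
1+n%2≢n%2 (suc zero)    ()
1+n%2≢n%2 (suc (suc n)) = 1+n%2≢n%2 n

I-shift : ∀ k n → I k (2 + n) ≡ I k n
I-shift k n with (2 + n) % 2 ℕ.≟ k % 2 | n % 2 ℕ.≟ k % 2
... | yes _ | yes _ = refl
... | no  _ | no  _ = refl
... | yes p | no ¬p = contradiction p ¬p
... | no ¬p | yes p = contradiction p ¬p

-- `suc k + e` has the parity of `k` exactly when `e` is odd, so the indicator is the gap between
-- the two roundings of `e / 2`.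
⌊/2⌋+I : ∀ k e → ⌊ e /2⌋ + I k (suc k + e) ≡ ⌈ e /2⌉
⌊/2⌋+I k zero rewrite ℕ.+-identityʳ k with suc k % 2 ℕ.≟ k % 2
... | yes p = contradiction p (1+n%2≢n%2 k)
... | no  _ = refl
⌊/2⌋+I k (suc zero) rewrite ℕ.+-comm k 1 with suc (suc k) % 2 ℕ.≟ k % 2
... | yes _ = refl
... | no ¬p = contradiction refl ¬p
⌊/2⌋+I k (suc (suc e)) = cong suc (trans (cong (⌊ e /2⌋ ℕ.+_)
    (trans (cong (I k) 1+k+2+e≡2+1+k+e) (I-shift k (suc k + e))))
  (⌊/2⌋+I k e))
  where
  1+k+2+e≡2+1+k+e : suc k + (2 + e) ≡ 2 + (suc k + e)
  1+k+2+e≡2+1+k+e = trans (ℕ.+-suc (suc k) (suc e)) (cong suc (ℕ.+-suc (suc k) e))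

-- Writes `e` through its lower half and the indicator, which makes the formula of the theorem
-- linear and accessible to the ring solver.
≡⌊/2⌋+⌊/2⌋+I : ∀ k e → e ≡ ⌊ e /2⌋ + (⌊ e /2⌋ + I k (suc k + e))
≡⌊/2⌋+⌊/2⌋+I k e = sym (trans (cong (⌊ e /2⌋ ℕ.+_) (⌊/2⌋+I k e)) (ℕ.⌊n/2⌋+⌈n/2⌉≡n e))

-- The right side is `2b - 2a`. Adding the indicators rounds `e` up to an even number and, because
-- `Δ` is subtracted, rounds `E` down.
numerator-≡ : ∀ k e E → numerator k (suc k + e) (suc k + E) ≡
              + (2 ℕ.* suc (k + ⌈ e /2⌉)) ℤ.- + (2 ℕ.* suc ⌊ E /2⌋)
numerator-≡ k e E = begin
  numerator k (suc k + e) (suc k + E)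
    ≡⟨ cong₂ (λ m n → + (suc k + m) ℤ.- + (suc k + n) ℤ.+ + (2 ℕ.* k) ℤ.+ + i ℤ.+ + j)
         (≡⌊/2⌋+⌊/2⌋+I k e) (≡⌊/2⌋+⌊/2⌋+I k E) ⟩
  + (suc k + (x + (x + i))) ℤ.- + (suc k + (y + (y + j))) ℤ.+ + (2 ℕ.* k) ℤ.+ + i ℤ.+ + j
    ≡⟨ solve 5 (λ k x y i j →
         (con (+ 1) :+ k :+ (x :+ (x :+ i))) :- (con (+ 1) :+ k :+ (y :+ (y :+ j)))
           :+ (k :+ (k :+ con (+ 0))) :+ i :+ j
           := ((con (+ 1) :+ (k :+ (x :+ i))) :+ ((con (+ 1) :+ (k :+ (x :+ i))) :+ con (+ 0)))
                :- ((con (+ 1) :+ y) :+ ((con (+ 1) :+ y) :+ con (+ 0))))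
         refl (+ k) (+ x) (+ y) (+ i) (+ j) ⟩
  + (2 ℕ.* suc (k + (x + i))) ℤ.- + (2 ℕ.* suc y)
    ≡⟨ cong (λ n → + (2 ℕ.* suc (k + n)) ℤ.- + (2 ℕ.* suc y)) (⌊/2⌋+I k e) ⟩
  + (2 ℕ.* suc (k + ⌈ e /2⌉)) ℤ.- + (2 ℕ.* suc ⌊ E /2⌋) ∎
  where
  open ≡-Reasoning
  open ℤ-Solver
  x = ⌊ e /2⌋
  y = ⌊ E /2⌋
  i = I k (suc k + e)
  j = I k (suc k + E)

denominator-≡ : ∀ k e E → denominator k (suc k + e) (suc k + E) ≡
                2 ℕ.* (suc (k + ⌈ e /2⌉) + suc ⌊ E /2⌋)
denominator-≡ k e E = begin
  (suc k + e + (suc k + E) + 2 + i) ℕ.∸ j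
    ≡⟨ cong₂ (λ m n → (suc k + m + (suc k + n) + 2 + i) ℕ.∸ j)
         (≡⌊/2⌋+⌊/2⌋+I k e) (≡⌊/2⌋+⌊/2⌋+I k E) ⟩
  (suc k + (x + (x + i)) + (suc k + (y + (y + j))) + 2 + i) ℕ.∸ j
    -- The indicator `j` is isolated as the last summand, so the truncated subtraction removes
    -- exactly it and leaves `2(b + a)`.
    ≡⟨ cong (ℕ._∸ j) (solve 5 (λ k x y i j →
         con 1 :+ k :+ (x :+ (x :+ i)) :+ (con 1 :+ k :+ (y :+ (y :+ j))) :+ con 2 :+ i
           := con 2 :* (con 1 :+ (k :+ (x :+ i)) :+ (con 1 :+ y)) :+ j) refl k x y i j) ⟩
  (2 ℕ.* (suc (k + (x + i)) + suc y) + j) ℕ.∸ j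
    ≡⟨ ℕ.m+n∸n≡m (2 ℕ.* (suc (k + (x + i)) + suc y)) j ⟩
  2 ℕ.* (suc (k + (x + i)) + suc y)
    ≡⟨ cong (λ n → 2 ℕ.* (suc (k + n) + suc y)) (⌊/2⌋+I k e) ⟩
  2 ℕ.* (suc (k + ⌈ e /2⌉) + suc ⌊ E /2⌋) ∎
  where
  open ≡-Reasoning
  open +-*-Solver
  x = ⌊ e /2⌋
  y = ⌊ E /2⌋
  i = I k (suc k + e)
  j = I k (suc k + E)

-- Choice of parameters and the infinite family.

≅⇒order≡ : ∀ {G H} → G ≅ H → Graph.order G ≡ Graph.order H
≅⇒order≡ G≅H = ↔⇒≡ (_≅_.bijection G≅H)

-- Serves twice: `E` gives `ρ + a = Δ + 1`, and `e` gives `b + σ = δ + 1`.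
halves-sum : ∀ k e → suc (k + ⌈ e /2⌉) + suc ⌊ e /2⌋ ≡ suc (suc k + e)
halves-sum k e = begin
  suc (k + ⌈ e /2⌉) + suc ⌊ e /2⌋
    ≡⟨ solve 3 (λ k x y → con 1 :+ (k :+ y) :+ (con 1 :+ x) := con 2 :+ (k :+ (x :+ y)))
         refl k ⌊ e /2⌋ ⌈ e /2⌉ ⟩
  2 + (k + (⌊ e /2⌋ + ⌈ e /2⌉))     ≡⟨ cong (λ n → 2 + (k + n)) (ℕ.⌊n/2⌋+⌈n/2⌉≡n e) ⟩
  2 + (k + e)                       ∎
  where
  open ≡-Reasoning
  open +-*-Solver

⌈n/2⌉≤1+⌊n/2⌋ : ∀ n → ⌈ n /2⌉ ≤ suc ⌊ n /2⌋
⌈n/2⌉≤1+⌊n/2⌋ zero          = z≤n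
⌈n/2⌉≤1+⌊n/2⌋ (suc zero)    = ℕ.≤-refl
⌈n/2⌉≤1+⌊n/2⌋ (suc (suc n)) = s≤s (⌈n/2⌉≤1+⌊n/2⌋ n)

theorem5 : ∀ (k : ℕ) → 1 ≤ k → ∀ (δ Δ : ℕ) → k + 1 ≤ δ → δ ≤ Δ →
    Σ[ 𝓕 ∈ (ℕ → Graph) ] (∀ (i j : ℕ) → i ≢ j → ¬ (𝓕 i ≅ 𝓕 j)) ×
    (∀ (i : ℕ) → MinDegree (𝓕 i) δ × MaxDegree (𝓕 i) Δ ×
    (∃[ γ ] IsSignedDominationNumber k (𝓕 i) γ ×
    fromℤ γ ≡ fromℤ (+ Graph.order (𝓕 i)) * ratio k δ Δ))
theorem5 k _ δ Δ k+1≤δ δ≤Δ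
  with e , refl ← ℕ.m≤n⇒∃[o]m+o≡n (subst (_≤ δ) (ℕ.+-comm k 1) k+1≤δ)
  with E , refl ← ℕ.m≤n⇒∃[o]m+o≡n (ℕ.≤-trans (ℕ.m≤m+n (suc k) e) δ≤Δ)
  = 𝓕 , 𝓕-distinct , λ i →
    let open Construction (suc i) ρ σ b a
        Δ-nbhd = halves-sum k E
        δ-nbhd = halves-sum k e
    in minDegree Δ-nbhd δ-nbhd δ≤Δ zero zero zero zero
     , maxDegree Δ-nbhd δ-nbhd δ≤Δ zero zero zero zero
     , γ
     , isSignedDominationNumber k+a≤ρ k+σ≤b b≤ρ ρ≤1+k+a
     , fromℤ-*-/ γ (+ N) (numerator k δ Δ) (denominator k δ Δ) {{denominator-nonZero k δ Δ}}
         (trans (cong (λ n → γ ℤ.* + n) (denominator-≡ k e E))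
           (trans γ-ratio (cong (+ N ℤ.*_) (sym (numerator-≡ k e E)))))
  where
  ρ = suc (k + ⌈ E /2⌉)
  σ = suc ⌊ e /2⌋
  b = suc (k + ⌈ e /2⌉)
  a = suc ⌊ E /2⌋

  𝓕 : ℕ → Graph
  -- Taking `suc i` copies keeps the vertex set nonempty; the orders are distinct multiples of
  -- `ρσ(b + a)`, so no two members are isomorphic.
  𝓕 i = Construction.G (suc i) ρ σ b a

  𝓕-distinct : ∀ i j → i ≢ j → ¬ (𝓕 i ≅ 𝓕 j)
  𝓕-distinct i j i≢j 𝓕i≅𝓕j =
    i≢j (ℕ.suc-injective (ℕ.*-cancelʳ-≡ (suc i) (suc j) (ρ ℕ.* (σ ℕ.* (b + a))) (≅⇒order≡ 𝓕i≅𝓕j)))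

  k+a≤ρ : k + a ≤ ρ
  k+a≤ρ = subst (_≤ ρ) (sym (ℕ.+-suc k _)) (s≤s (ℕ.+-monoʳ-≤ k (ℕ.⌊n/2⌋≤⌈n/2⌉ E)))

  k+σ≤b : k + σ ≤ b
  k+σ≤b = subst (_≤ b) (sym (ℕ.+-suc k _)) (s≤s (ℕ.+-monoʳ-≤ k (ℕ.⌊n/2⌋≤⌈n/2⌉ e)))

  b≤ρ : b ≤ ρ
  b≤ρ = s≤s (ℕ.+-monoʳ-≤ k (ℕ.⌈n/2⌉-mono (ℕ.+-cancelˡ-≤ (suc k) e E δ≤Δ)))

  ρ≤1+k+a : ρ ≤ suc (k + a)
  ρ≤1+k+a = s≤s (ℕ.+-monoʳ-≤ k (⌈n/2⌉≤1+⌊n/2⌋ E))
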